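{- For all $e, f \in \mathbb{E}$: \[ e \equiv f \iff (\forall M)\big([\![ e ]\!]_M = [\![ f ]\!]_M\big). \]
   Context: Fix countably infinite disjoint alphabets $\Sigma$ (atomic actions) and $\Pi$ (atomic propositions). The set $\mathbb{E}$ of expressions is given by $e,f ::= \mathtt{a}\in\Sigma \mid \mathtt{p}\in\Pi \mid \mathtt{0} \mid \mathtt{1} \mid e+f \mid e\cdot f \mid e^{\bot} \mid e^{\top} \mid e^{*}$ ($^{\bot}$ antidomain, $^{\top}$ domain). $\equiv$ is the smallest congruence on $\mathbb{E}$ satisfying the Kleene algebra axioms (idempotent semiring laws, $\mathtt{1}+e\cdot e^{*}\leqq e^{*}$, $\mathtt{1}+e^{*}\cdot e\leqq e^{*}$, $f+e\cdot g\leqq g \Rightarrow e^{*}\cdot f\leqq g$, $f+g\cdot e\leqq g\Rightarrow f\cdot e^{*}\leqq g$) together with $e^{\bot}\cdot e\equiv\mathtt{0}$, $(e\cdot f)^{\bot}\equiv(e\cdot f^{\top})^{\bot}$, $e^{\bot}+e^{\top}\equiv\mathtt{1}$, $\mathtt{p}^{\top}\equiv\mathtt{p}$ ($\mathtt{p}\in\Pi$), $e^{\top}\equiv e^{\bot\bot}$; $e\leqq f$ means $e+f\equiv f$. $M$ ranges over relational models $M=\langle X,\mathsf{rel}_M,\mathsf{sat}_M\rangle$ with $\mathsf{rel}_M:\Sigma\to 2^{X\times X}$, $\mathsf{sat}_M:\Pi\to 2^X$. The interpretation $[\![ - ]\!]_M:\mathbb{E}\to 2^{X\times X}$ is: $[\![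 \mathtt{a} ]\!]_M=\mathsf{rel}_M(\mathtt{a})$, $[\![ \mathtt{p} ]\!]_M$ = identity relation on $\mathsf{sat}_M(\mathtt{p})$, $[\![ \mathtt{0} ]\!]_M=\emptyset$, $[\![ \mathtt{1} ]\!]_M=1_X$, $+$ as union, $\cdot$ as relational composition, $^{*}$ as reflexive transitive closure, $[\![ e^{\bot} ]\!]_M=\{\langle x,x\rangle\mid \neg\exists y\,\langle x,y\rangle\in[\![ e ]\!]_M\}$, $[\![ e^{\top} ]\!]_M=\{\langle x,x\rangle\mid \exists y\,\langle x,y\rangle\in[\![ e ]\!]_M\}$. -}

module Defs where

open import Level using (0ℓ)
open import Data.Nat using (ℕ)
open import Data.Product using (Σ; ∃; _×_; _,_)
open import Data.Sum using (_⊎_)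
open import Data.Empty using (⊥)
open import Relation.Nullary using (¬_)
open import Relation.Binary.PropositionalEquality using (_≡_)
open import Relation.Binary.Construct.Closure.ReflexiveTransitive using (Star)

-- Atomic actions Σ and atomic propositions Π: both countably infinite,
-- represented by ℕ (kept disjoint by separate constructors).
Act : Set
Act = ℕ

Prop : Set
Prop = ℕ

infixl 6 _⊕_
infixl 7 _⊙_

data Exp : Set where
  act  : Act → Exp
  prop : Prop → Exp
  𝟘    : Exp
  𝟙    : Exp
  _⊕_  : Exp → Exp → Exp
  _⊙_  : Exp → Exp → Exp
  ad   : Exp → Exp
  dom  : Exp → Exp
  star : Exp → Exp

infix 4 _≈_ _≦_

data _≈_ : Exp → Exp → Set

_≦_ : Exp → Exp → Set
e ≦ f = e ⊕ f ≈ f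

data _≈_ where
  ≈-refl  : ∀ {e} → e ≈ e
  ≈-sym   : ∀ {e f} → e ≈ f → f ≈ e
  ≈-trans : ∀ {e f g} → e ≈ f → f ≈ g → e ≈ g
  ⊕-cong    : ∀ {e e' f f'} → e ≈ e' → f ≈ f' → e ⊕ f ≈ e' ⊕ f'
  ⊙-cong    : ∀ {e e' f f'} → e ≈ e' → f ≈ f' → e ⊙ f ≈ e' ⊙ f'
  ad-cong   : ∀ {e e'} → e ≈ e' → ad e ≈ ad e'
  dom-cong  : ∀ {e e'} → e ≈ e' → dom e ≈ dom e'
  star-cong : ∀ {e e'} → e ≈ e' → star e ≈ star e'
  ⊕-assoc  : ∀ e f g → (e ⊕ f) ⊕ g ≈ e ⊕ (f ⊕ g)
  ⊕-comm   : ∀ e f → e ⊕ f ≈ f ⊕ e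
  ⊕-idem   : ∀ e → e ⊕ e ≈ e
  ⊕-identʳ : ∀ e → e ⊕ 𝟘 ≈ e
  ⊙-assoc  : ∀ e f g → (e ⊙ f) ⊙ g ≈ e ⊙ (f ⊙ g)
  ⊙-identˡ : ∀ e → 𝟙 ⊙ e ≈ e
  ⊙-identʳ : ∀ e → e ⊙ 𝟙 ≈ e
  distribˡ : ∀ e f g → e ⊙ (f ⊕ g) ≈ (e ⊙ f) ⊕ (e ⊙ g)
  distribʳ : ∀ e f g → (f ⊕ g) ⊙ e ≈ (f ⊙ e) ⊕ (g ⊙ e)
  zeroˡ    : ∀ e → 𝟘 ⊙ e ≈ 𝟘
  zeroʳ    : ∀ e → e ⊙ 𝟘 ≈ 𝟘
  star-unfoldˡ : ∀ e → 𝟙 ⊕ e ⊙ star e ≦ star e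
  star-unfoldʳ : ∀ e → 𝟙 ⊕ star e ⊙ e ≦ star e
  star-indˡ    : ∀ {e f g} → f ⊕ e ⊙ g ≦ g → star e ⊙ f ≦ g
  star-indʳ    : ∀ {e f g} → f ⊕ g ⊙ e ≦ g → f ⊙ star e ≦ g
  ad-annihil : ∀ e → ad e ⊙ e ≈ 𝟘
  ad-local   : ∀ e f → ad (e ⊙ f) ≈ ad (e ⊙ dom f)
  ad-compl   : ∀ e → ad e ⊕ dom e ≈ 𝟙
  prop-dom   : ∀ p → dom (prop p) ≈ prop p
  dom-def    : ∀ e → dom e ≈ ad (ad e)

record Model : Set₁ where
  field
    X   : Set
    rel : Act → X → X → Set
    sat : Prop → X → Set

Rel : Set → Set₁
Rel X = X → X → Set

⟦_⟧ : Exp → (M : Model) → Rel (Model.X M)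
⟦ act a  ⟧ M x y = Model.rel M a x y
⟦ prop p ⟧ M x y = x ≡ y × Model.sat M p x
⟦ 𝟘      ⟧ M x y = ⊥
⟦ 𝟙      ⟧ M x y = x ≡ y
⟦ e ⊕ f  ⟧ M x y = ⟦ e ⟧ M x y ⊎ ⟦ f ⟧ M x y
⟦ e ⊙ f  ⟧ M x y = ∃ λ z → ⟦ e ⟧ M x z × ⟦ f ⟧ M z y
⟦ ad e   ⟧ M x y = x ≡ y × ¬ (∃ λ z → ⟦ e ⟧ M x z)
⟦ dom e  ⟧ M x y = x ≡ y × ∃ λ z → ⟦ e ⟧ M x z
⟦ star e ⟧ M x y = Star (⟦ e ⟧ M) x y

SameRel : ∀ {X : Set} → Rel X → Rel X → Set
SameRel R S = ∀ x y → (R x y → S x y) × (S x y → R x y)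

{-# OPTIONS --safe #-}

-- Completeness evaluates e and f in one finite model. A state is a pair (α, V): α is an atom,
-- i.e. a product of literals dom x, ad x for finitely many relevant x, and V is a set of
-- continuations of f. An action a leads from (α, V) to (β, V′) if α a β ≉ 𝟘 and V′ consists of
-- the k′ with α a β k′ ≦ k for some k ∈ V: a subset automaton for f whose transitions are
-- provable inequalities. Kleene's construction yields an expression route s t for the paths
-- from s to t, and by induction on e, α e ≦ Σ { route s t ∣ (s , t) ∈ ⟦ e ⟧ } for s = (α, V);
-- simultaneously, α ≦ dom e if e can be run from s, so each α evaluates tests correctly.
-- Conversely, if V consists of the k with α k ≦ f, then route s t ≦ f for every
-- (s , t) ∈ ⟦ f ⟧, because path expressions are least solutions and V bounds what is left to
-- be done. So ⟦ e ⟧ ⊆ ⟦ f ⟧ gives α e ≦ f, and the atoms sum to 𝟙.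

module Submission where

open import Defs
open import Level using (0ℓ)
open import Axiom.ExcludedMiddle using (ExcludedMiddle)
open import Function.Bundles using (_⇔_; mk⇔)
open import Function.Base using (_∘_)
open import Data.Bool.Base using (Bool; true; false; if_then_else_)
open import Data.Fin.Base using (Fin)
open import Data.List.Base using (List; []; _∷_; [_]; _++_; map; length; lookup; allFin; cartesianProduct)
open import Data.List.Membership.Propositional using (_∈_)
open import Data.List.Membership.Propositional.Properties
  using (∈-++⁺ˡ; ∈-++⁺ʳ; ∈-map⁺; ∈-allFin; ∈-cartesianProduct⁺)
open import Data.List.Relation.Binary.Subset.Propositional using (_⊆_)
open import Data.List.Relation.Unary.Any using (here; there; index)
open import Data.List.Relation.Unary.Any.Properties using (lookup-index)
open import Data.Nat.Base using (zero; suc)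
open import Data.Product using (∃; _×_; _,_; proj₁; proj₂)
open import Data.Sum.Base using (_⊎_; inj₁; inj₂; [_,_]′)
import Data.Sum.Base as Sum
open import Data.Vec.Base as Vec using (Vec; []; _∷_)
open import Data.Vec.Properties using (lookup∘tabulate)
open import Relation.Binary.Bundles using (Poset)
open import Relation.Binary.Construct.Closure.ReflexiveTransitive as Star using (Star; ε; _◅_; _◅◅_)
open import Relation.Binary.PropositionalEquality using (_≡_; refl; sym; trans; subst)
import Relation.Binary.Reasoning.PartialOrder as PosetReasoning
open import Relation.Nullary using (¬_; yes; no; does; contradiction)

private variable
  c e f g h k x y : Exp

-- Kleene algebra with domain

≈⇒≦ : e ≈ f → e ≦ f
≈⇒≦ p = ≈-trans (⊕-cong p ≈-refl) (⊕-idem _)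

≦-refl : e ≦ e
≦-refl = ⊕-idem _

≦-trans : e ≦ f → f ≦ g → e ≦ g
≦-trans p q =
  ≈-trans (⊕-cong ≈-refl (≈-sym q))
  (≈-trans (≈-sym (⊕-assoc _ _ _)) (≈-trans (⊕-cong p ≈-refl) q))

≦-antisym : e ≦ f → f ≦ e → e ≈ f
≦-antisym p q = ≈-trans (≈-sym q) (≈-trans (⊕-comm _ _) p)

≦-poset : Poset 0ℓ 0ℓ 0ℓ
≦-poset = record
  { Carrier = Exp ; _≈_ = _≈_ ; _≤_ = _≦_
  ; isPartialOrder = record
    { isPreorder = record
      { isEquivalence = record { refl = ≈-refl ; sym = ≈-sym ; trans = ≈-trans }
      ; reflexive = ≈⇒≦ ; trans = ≦-trans }
    ; antisym = ≦-antisym } }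

open PosetReasoning ≦-poset

𝟘≦ : 𝟘 ≦ e
𝟘≦ = ≈-trans (⊕-comm _ _) (⊕-identʳ _)

≦𝟘⇒≈𝟘 : e ≦ 𝟘 → e ≈ 𝟘
≦𝟘⇒≈𝟘 p = ≦-antisym p 𝟘≦

⊕-upperˡ : e ≦ e ⊕ f
⊕-upperˡ = ≈-trans (≈-sym (⊕-assoc _ _ _)) (⊕-cong (⊕-idem _) ≈-refl)

⊕-upperʳ : f ≦ e ⊕ f
⊕-upperʳ = ≦-trans ⊕-upperˡ (≈⇒≦ (⊕-comm _ _))

⊕-least : e ≦ g → f ≦ g → e ⊕ f ≦ g
⊕-least p q = ≈-trans (⊕-assoc _ _ _) (≈-trans (⊕-cong ≈-refl q) p)

⊙-monoʳ : e ≦ f → g ⊙ e ≦ g ⊙ f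
⊙-monoʳ p = ≈-trans (≈-sym (distribˡ _ _ _)) (⊙-cong ≈-refl p)

⊙-monoˡ : e ≦ f → e ⊙ g ≦ f ⊙ g
⊙-monoˡ p = ≈-trans (≈-sym (distribʳ _ _ _)) (⊙-cong p ≈-refl)

⊙-mono : e ≦ f → g ≦ h → e ⊙ g ≦ f ⊙ h
⊙-mono p q = ≦-trans (⊙-monoˡ p) (⊙-monoʳ q)

≦𝟙⇒⊙-lowerʳ : e ≦ 𝟙 → e ⊙ f ≦ f
≦𝟙⇒⊙-lowerʳ p = ≦-trans (⊙-monoˡ p) (≈⇒≦ (⊙-identˡ _))

≦𝟙⇒⊙-lowerˡ : f ≦ 𝟙 → e ⊙ f ≦ e
≦𝟙⇒⊙-lowerˡ p = ≦-trans (⊙-monoʳ p) (≈⇒≦ (⊙-identʳ _))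

𝟙≦star : 𝟙 ≦ star e
𝟙≦star = ≦-trans ⊕-upperˡ (star-unfoldˡ _)

star-stepˡ : e ⊙ star e ≦ star e
star-stepˡ = ≦-trans ⊕-upperʳ (star-unfoldˡ _)

star-stepʳ : star e ⊙ e ≦ star e
star-stepʳ = ≦-trans ⊕-upperʳ (star-unfoldʳ _)

star-⊙-star : star e ⊙ star e ≦ star e
star-⊙-star = star-indˡ (⊕-least ≦-refl star-stepˡ)

⊙-star-⊙-star : f ⊙ star e ⊙ star e ≦ f ⊙ star e
⊙-star-⊙-star = ≦-trans (≈⇒≦ (⊙-assoc _ _ _)) (⊙-monoʳ star-⊙-star)

⊙-star-lowerʳ : f ≦ star e ⊙ f
⊙-star-lowerʳ = ≦-trans (≈⇒≦ (≈-sym (⊙-identˡ _))) (⊙-monoˡ 𝟙≦star)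

⊙-star-lowerˡ : f ≦ f ⊙ star e
⊙-star-lowerˡ = ≦-trans (≈⇒≦ (≈-sym (⊙-identʳ _))) (⊙-monoʳ 𝟙≦star)

ad≦𝟙 : ad e ≦ 𝟙
ad≦𝟙 = ≦-trans ⊕-upperˡ (≈⇒≦ (ad-compl _))

dom≦𝟙 : dom e ≦ 𝟙
dom≦𝟙 = ≦-trans ⊕-upperʳ (≈⇒≦ (ad-compl _))

ad-dom : ad (dom e) ≈ ad e
ad-dom = ≈-trans (ad-cong (≈-sym (⊙-identˡ _)))
  (≈-trans (≈-sym (ad-local _ _)) (ad-cong (⊙-identˡ _)))

ad⊙dom≈𝟘 : ad e ⊙ dom e ≈ 𝟘
ad⊙dom≈𝟘 = ≈-trans (⊙-cong (≈-sym ad-dom) ≈-refl) (ad-annihil _)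

dom⊙ad≈𝟘 : dom e ⊙ ad e ≈ 𝟘
dom⊙ad≈𝟘 = ≈-trans (⊙-cong (dom-def _) ≈-refl) (ad-annihil _)

splitʳ : e ≈ e ⊙ ad x ⊕ e ⊙ dom x
splitʳ = ≈-trans (≈-sym (⊙-identʳ _))
  (≈-trans (⊙-cong ≈-refl (≈-sym (ad-compl _))) (distribˡ _ _ _))

ad-𝟘 : ad 𝟘 ≈ 𝟙
ad-𝟘 = begin-equality
  ad 𝟘           ≈⟨ ad-cong ad-𝟙 ⟨
  ad (ad 𝟙)      ≈⟨ dom-def _ ⟨
  dom 𝟙          ≈⟨ 𝟘≦ ⟨
  𝟘 ⊕ dom 𝟙      ≈⟨ ⊕-cong ad-𝟙 ≈-refl ⟨
  ad 𝟙 ⊕ dom 𝟙   ≈⟨ ad-compl _ ⟩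
  𝟙              ∎
  where
  ad-𝟙 : ad 𝟙 ≈ 𝟘
  ad-𝟙 = ≈-trans (≈-sym (⊙-identʳ _)) (ad-annihil _)

-- Locality at work: `ad (e ⊙ x)` is `𝟙` here, and `ad-local` equates it with `ad (e ⊙ dom x)`,
-- which annihilates `e ⊙ dom x`.
⊙≈𝟘⇒⊙dom≈𝟘 : e ⊙ x ≈ 𝟘 → e ⊙ dom x ≈ 𝟘
⊙≈𝟘⇒⊙dom≈𝟘 {e} {x} p = begin-equality
  e ⊙ dom x                         ≈⟨ ⊙-identˡ _ ⟨
  𝟙 ⊙ (e ⊙ dom x)                   ≈⟨ ⊙-cong ad-𝟘 ≈-refl ⟨
  ad 𝟘 ⊙ (e ⊙ dom x)                ≈⟨ ⊙-cong (ad-cong p) ≈-refl ⟨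
  ad (e ⊙ x) ⊙ (e ⊙ dom x)          ≈⟨ ⊙-cong (ad-local _ _) ≈-refl ⟩
  ad (e ⊙ dom x) ⊙ (e ⊙ dom x)      ≈⟨ ad-annihil _ ⟩
  𝟘                                 ∎

-- With the converse that follows, this makes `ad x` the greatest subidentity annihilating `x` from
-- the left.
⊙≈𝟘⇒≦ad : e ≦ 𝟙 → e ⊙ x ≈ 𝟘 → e ≦ ad x
⊙≈𝟘⇒≦ad {e} {x} e≦𝟙 p = begin
  e                        ≈⟨ splitʳ ⟩
  e ⊙ ad x ⊕ e ⊙ dom x     ≈⟨ ⊕-cong ≈-refl (⊙≈𝟘⇒⊙dom≈𝟘 p) ⟩
  e ⊙ ad x ⊕ 𝟘             ≈⟨ ⊕-identʳ _ ⟩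
  e ⊙ ad x                 ≤⟨ ≦𝟙⇒⊙-lowerʳ e≦𝟙 ⟩
  ad x                     ∎

≦ad⇒⊙≈𝟘 : e ≦ ad x → e ⊙ x ≈ 𝟘
≦ad⇒⊙≈𝟘 p = ≦𝟘⇒≈𝟘 (≦-trans (⊙-monoˡ p) (≈⇒≦ (ad-annihil _)))

ad-anti : e ≦ f → ad f ≦ ad e
ad-anti p = ⊙≈𝟘⇒≦ad ad≦𝟙 (≦𝟘⇒≈𝟘 (≦-trans (⊙-monoʳ p) (≈⇒≦ (ad-annihil _))))

dom-mono : e ≦ f → dom e ≦ dom f
dom-mono {e} {f} p = begin
  dom e       ≈⟨ dom-def _ ⟩
  ad (ad e)   ≤⟨ ad-anti (ad-anti p) ⟩
  ad (ad f)   ≈⟨ dom-def _ ⟨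
  dom f       ∎

dom-local : dom (e ⊙ dom f) ≈ dom (e ⊙ f)
dom-local = ≈-trans (dom-def _)
  (≈-trans (ad-cong (≈-sym (ad-local _ _))) (≈-sym (dom-def _)))

-- The common behaviour of `ad x` and `dom x`, each the complement of the other, so that literals of
-- either sign are treated at once.
record Complemented (p : Exp) : Set where
  field
    compl   : Exp
    covers  : p ⊕ compl ≈ 𝟙
    annihʳ  : p ⊙ compl ≈ 𝟘
    annihˡ  : compl ⊙ p ≈ 𝟘

  ⊙-idem : p ⊙ p ≈ p
  ⊙-idem = begin-equality
    p ⊙ p               ≈⟨ ⊕-identʳ _ ⟨
    p ⊙ p ⊕ 𝟘           ≈⟨ ⊕-cong ≈-refl annihʳ ⟨
    p ⊙ p ⊕ p ⊙ compl   ≈⟨ distribˡ _ _ _ ⟨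
    p ⊙ (p ⊕ compl)     ≈⟨ ⊙-cong ≈-refl covers ⟩
    p ⊙ 𝟙               ≈⟨ ⊙-identʳ _ ⟩
    p                   ∎

  ≦𝟙 : p ≦ 𝟙
  ≦𝟙 = ≦-trans ⊕-upperˡ (≈⇒≦ covers)

  -- Both sides equal `p ⊙ c ⊙ p`: as `c` is below `𝟙`, the part through `compl` is below
  -- `p ⊙ compl` or `compl ⊙ p`, hence `𝟘`.
  central : c ≦ 𝟙 → p ⊙ c ≈ c ⊙ p
  central {c} c≦𝟙 = ≈-trans pc≈pcp (≈-sym cp≈pcp)
    where
    pc≈pcp : p ⊙ c ≈ p ⊙ c ⊙ p
    pc≈pcp = ≦-antisym
      (begin
        p ⊙ c                          ≈⟨ ⊙-identʳ _ ⟨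
        p ⊙ c ⊙ 𝟙                      ≈⟨ ⊙-cong ≈-refl covers ⟨
        p ⊙ c ⊙ (p ⊕ compl)            ≈⟨ distribˡ _ _ _ ⟩
        p ⊙ c ⊙ p ⊕ p ⊙ c ⊙ compl      ≤⟨ ⊕-least ≦-refl (begin
          p ⊙ c ⊙ compl                ≤⟨ ⊙-monoˡ (≦𝟙⇒⊙-lowerˡ c≦𝟙) ⟩
          p ⊙ compl                    ≈⟨ annihʳ ⟩
          𝟘                            ≤⟨ 𝟘≦ ⟩
          p ⊙ c ⊙ p                    ∎) ⟩
        p ⊙ c ⊙ p                      ∎)
      (≦𝟙⇒⊙-lowerˡ ≦𝟙)
    cp≈pcp : c ⊙ p ≈ p ⊙ c ⊙ p
    cp≈pcp = ≦-antisym
      (begin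
        c ⊙ p                              ≈⟨ ⊙-identˡ _ ⟨
        𝟙 ⊙ (c ⊙ p)                        ≈⟨ ⊙-cong covers ≈-refl ⟨
        (p ⊕ compl) ⊙ (c ⊙ p)              ≈⟨ distribʳ _ _ _ ⟩
        p ⊙ (c ⊙ p) ⊕ compl ⊙ (c ⊙ p)      ≤⟨ ⊕-least (≈⇒≦ (≈-sym (⊙-assoc _ _ _))) (begin
          compl ⊙ (c ⊙ p)                  ≤⟨ ⊙-monoʳ (≦𝟙⇒⊙-lowerʳ c≦𝟙) ⟩
          compl ⊙ p                        ≈⟨ annihˡ ⟩
          𝟘                                ≤⟨ 𝟘≦ ⟩
          p ⊙ c ⊙ p                        ∎) ⟩
        p ⊙ c ⊙ p                          ∎)
      (≦-trans (≈⇒≦ (⊙-assoc _ _ _)) (≦𝟙⇒⊙-lowerʳ ≦𝟙))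

ad-complemented : Complemented (ad x)
ad-complemented = record
  { compl = dom _ ; covers = ad-compl _ ; annihʳ = ad⊙dom≈𝟘 ; annihˡ = dom⊙ad≈𝟘 }

dom-complemented : Complemented (dom x)
dom-complemented = record
  { compl = ad _ ; covers = ≈-trans (⊕-comm _ _) (ad-compl _)
  ; annihʳ = dom⊙ad≈𝟘 ; annihˡ = ad⊙dom≈𝟘 }

-- Atoms over a list of expressions

literal : Bool → Exp → Exp
literal true  x = dom x
literal false x = ad x

literal-complemented : ∀ b → Complemented (literal b x)
literal-complemented true  = dom-complemented
literal-complemented false = ad-complemented

atom : (xs : List Exp) → Vec Bool (length xs) → Exp
atom []       []       = 𝟙
atom (x ∷ xs) (b ∷ bs) = literal b x ⊙ atom xs bs

atom≦𝟙 : ∀ xs bs → atom xs bs ≦ 𝟙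
atom≦𝟙 []       []       = ≦-refl
atom≦𝟙 (x ∷ xs) (b ∷ bs) =
  ≦-trans (≦𝟙⇒⊙-lowerʳ (Complemented.≦𝟙 (literal-complemented b))) (atom≦𝟙 xs bs)

atom-central : ∀ xs bs → c ≦ 𝟙 → atom xs bs ⊙ c ≈ c ⊙ atom xs bs
atom-central []       []       c≦𝟙 = ≈-trans (⊙-identˡ _) (≈-sym (⊙-identʳ _))
atom-central {c} (x ∷ xs) (b ∷ bs) c≦𝟙 = begin-equality
  l ⊙ α ⊙ c      ≈⟨ ⊙-assoc _ _ _ ⟩
  l ⊙ (α ⊙ c)    ≈⟨ ⊙-cong ≈-refl (atom-central xs bs c≦𝟙) ⟩
  l ⊙ (c ⊙ α)    ≈⟨ ⊙-assoc _ _ _ ⟨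
  l ⊙ c ⊙ α      ≈⟨ ⊙-cong (Complemented.central (literal-complemented b) c≦𝟙) ≈-refl ⟩
  c ⊙ l ⊙ α      ≈⟨ ⊙-assoc _ _ _ ⟩
  c ⊙ (l ⊙ α)    ∎
  where
  l = literal b x
  α = atom xs bs

atom-idem : ∀ xs bs → atom xs bs ⊙ atom xs bs ≈ atom xs bs
atom-idem []       []       = ⊙-identˡ _
atom-idem (x ∷ xs) (b ∷ bs) = begin-equality
  l ⊙ α ⊙ (l ⊙ α)      ≈⟨ ⊙-assoc _ _ _ ⟨
  l ⊙ α ⊙ l ⊙ α        ≈⟨ ⊙-cong (⊙-cong (L.central (atom≦𝟙 xs bs)) ≈-refl) ≈-refl ⟩
  α ⊙ l ⊙ l ⊙ α        ≈⟨ ⊙-cong (⊙-assoc _ _ _) ≈-refl ⟩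
  α ⊙ (l ⊙ l) ⊙ α      ≈⟨ ⊙-cong (⊙-cong ≈-refl L.⊙-idem) ≈-refl ⟩
  α ⊙ l ⊙ α            ≈⟨ ⊙-cong (L.central (atom≦𝟙 xs bs)) ≈-refl ⟨
  l ⊙ α ⊙ α            ≈⟨ ⊙-assoc _ _ _ ⟩
  l ⊙ (α ⊙ α)          ≈⟨ ⊙-cong ≈-refl (atom-idem xs bs) ⟩
  l ⊙ α                ∎
  where
  module L = Complemented (literal-complemented {x} b)
  l = literal b x
  α = atom xs bs

-- The atom commutes with its antidomain, so their product vanishes and `α` lies below `ad (ad α)`.
atom≦dom-atom : ∀ xs bs → atom xs bs ≦ dom (atom xs bs)
atom≦dom-atom xs bs = begin
  α            ≤⟨ ⊙≈𝟘⇒≦ad (atom≦𝟙 xs bs) (≈-trans (atom-central xs bs ad≦𝟙) (ad-annihil _)) ⟩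
  ad (ad α)    ≈⟨ dom-def _ ⟨
  dom α        ∎
  where α = atom xs bs

atom-decides : ∀ xs bs → x ∈ xs → atom xs bs ≦ dom x ⊎ atom xs bs ≦ ad x
atom-decides (x ∷ xs) (true  ∷ bs) (here refl) = inj₁ (≦𝟙⇒⊙-lowerˡ (atom≦𝟙 xs bs))
atom-decides (x ∷ xs) (false ∷ bs) (here refl) = inj₂ (≦𝟙⇒⊙-lowerˡ (atom≦𝟙 xs bs))
atom-decides (x ∷ xs) (b ∷ bs)     (there x∈xs) =
  Sum.map (≦-trans lower) (≦-trans lower) (atom-decides xs bs x∈xs)
  where
  lower : atom (x ∷ xs) (b ∷ bs) ≦ atom xs bs
  lower = ≦𝟙⇒⊙-lowerʳ (Complemented.≦𝟙 (literal-complemented b))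

-- The atoms sum to `𝟙`, cast as a case distinction so that the sum is never written out. `h`
-- accumulates the literals chosen so far.
atom-split : ∀ xs → (∀ bs → h ⊙ atom xs bs ⊙ k ≦ y) → h ⊙ k ≦ y
atom-split []       p = ≦-trans (⊙-monoˡ (≈⇒≦ (≈-sym (⊙-identʳ _)))) (p [])
atom-split {h} {k} {y} (x ∷ xs) p = begin
  h ⊙ k                           ≤⟨ ⊙-monoˡ (≈⇒≦ splitʳ) ⟩
  (h ⊙ ad x ⊕ h ⊙ dom x) ⊙ k      ≈⟨ distribʳ _ _ _ ⟩
  h ⊙ ad x ⊙ k ⊕ h ⊙ dom x ⊙ k    ≤⟨ ⊕-least (half false) (half true) ⟩
  y                               ∎
  where
  half : ∀ b → h ⊙ literal b x ⊙ k ≦ y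
  half b = atom-split xs λ bs →
    ≦-trans (⊙-monoˡ (≈⇒≦ (⊙-assoc _ _ _))) (p (b ∷ bs))

-- Kleene's path expressions

module Path {S : Set} (edge : S → S → Exp) where

  path : List S → S → S → Exp
  path []       s t = edge s t
  path (u ∷ us) s t = path us s t ⊕ path us s u ⊙ star (path us u u) ⊙ path us u t

  edge≦path : ∀ us {s t} → edge s t ≦ path us s t
  edge≦path []       = ≦-refl
  edge≦path (u ∷ us) = ≦-trans (edge≦path us) ⊕-upperˡ

  -- Loops at `u` are absorbed by `star-indˡ`, since by induction the loop expression `q` maps `Y u`
  -- below itself.
  path-least : ∀ {Y : S → Exp} → (∀ s t → edge s t ⊙ Y t ≦ Y s) →
    ∀ us s t → path us s t ⊙ Y t ≦ Y s
  path-least p []       s t = p s t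
  path-least {Y} p (u ∷ us) s t = begin
    (p₁ ⊕ p₂ ⊙ star q ⊙ p₃) ⊙ Y t             ≈⟨ distribʳ _ _ _ ⟩
    p₁ ⊙ Y t ⊕ p₂ ⊙ star q ⊙ p₃ ⊙ Y t         ≤⟨ ⊕-least (path-least p us s t) (begin
      p₂ ⊙ star q ⊙ p₃ ⊙ Y t                  ≈⟨ ⊙-assoc _ _ _ ⟩
      p₂ ⊙ star q ⊙ (p₃ ⊙ Y t)                ≤⟨ ⊙-monoʳ (path-least p us u t) ⟩
      p₂ ⊙ star q ⊙ Y u                       ≈⟨ ⊙-assoc _ _ _ ⟩
      p₂ ⊙ (star q ⊙ Y u)                     ≤⟨ ⊙-monoʳ (star-indˡ (⊕-least ≦-refl
                                                   (path-least p us u u))) ⟩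
      p₂ ⊙ Y u                                ≤⟨ path-least p us s u ⟩
      Y s                                     ∎) ⟩
    Y s                                       ∎
    where
    p₁ = path us s t
    p₂ = path us s u
    q  = path us u u
    p₃ = path us u t

  -- If `t` is the head, both factors become paths through `u` and the two stars merge. Otherwise
  -- the factors concatenate at `t` within `us`, and any new loop at `u` is absorbed into its star.
  path-trans : ∀ us {s t v} → t ∈ us → path us s t ⊙ path us t v ≦ path us s v
  path-trans (u ∷ us) {s} {t} {v} (here refl) = begin
    (p₁ ⊕ p₁ ⊙ star q ⊙ q) ⊙ (p₂ ⊕ q ⊙ star q ⊙ p₂)   ≤⟨ ⊙-mono
      (⊕-least ⊙-star-lowerˡ (≦-trans (≈⇒≦ (⊙-assoc _ _ _)) (⊙-monoʳ star-stepʳ)))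
      (⊕-least ⊙-star-lowerʳ (⊙-monoˡ star-stepˡ)) ⟩
    (p₁ ⊙ star q) ⊙ (star q ⊙ p₂)                     ≈⟨ ⊙-assoc _ _ _ ⟨
    p₁ ⊙ star q ⊙ star q ⊙ p₂                         ≤⟨ ⊙-monoˡ ⊙-star-⊙-star ⟩
    p₁ ⊙ star q ⊙ p₂                                  ≤⟨ ⊕-upperʳ ⟩
    path us s v ⊕ p₁ ⊙ star q ⊙ p₂                    ∎
    where
    p₁ = path us s u
    q  = path us u u
    p₂ = path us u v
  path-trans (u ∷ us) {s} {t} {v} (there t∈us) = begin
    (st ⊕ r ⊙ ut) ⊙ (tv ⊕ tu ⊙ star q ⊙ uv)       ≈⟨ distribʳ _ _ _ ⟩
    st ⊙ (tv ⊕ tu ⊙ star q ⊙ uv) ⊕ r ⊙ ut ⊙ (tv ⊕ tu ⊙ star q ⊙ uv)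
                                                 ≤⟨ ⊕-least (expand s) (begin
      r ⊙ ut ⊙ (tv ⊕ tu ⊙ star q ⊙ uv)             ≈⟨ ⊙-assoc _ _ _ ⟩
      r ⊙ (ut ⊙ (tv ⊕ tu ⊙ star q ⊙ uv))           ≤⟨ ⊙-monoʳ viaU ⟩
      r ⊙ (star q ⊙ uv)                            ≈⟨ ⊙-assoc _ _ _ ⟨
      r ⊙ star q ⊙ uv                              ≤⟨ ⊙-monoˡ ⊙-star-⊙-star ⟩
      r ⊙ uv                                       ≤⟨ ⊕-upperʳ ⟩
      path us s v ⊕ r ⊙ uv                         ∎) ⟩
    path us s v ⊕ r ⊙ uv                          ∎
    where
    st = path us s t
    tv = path us t v
    su = path us s u
    ut = path us u t
    tu = path us t u
    uv = path us u v
    q  = path us u u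
    r  = su ⊙ star q

    -- The start `w` is a variable because the segment that ends in `t` begins at `s` or, after a
    -- visit to `u`, at `u`.
    expand : ∀ w → path us w t ⊙ (tv ⊕ tu ⊙ star q ⊙ uv)
                   ≦ path us w v ⊕ path us w u ⊙ star q ⊙ uv
    expand w = begin
      path us w t ⊙ (tv ⊕ tu ⊙ star q ⊙ uv)                     ≈⟨ distribˡ _ _ _ ⟩
      path us w t ⊙ tv ⊕ path us w t ⊙ (tu ⊙ star q ⊙ uv)       ≤⟨ ⊕-least
        (≦-trans (path-trans us t∈us) ⊕-upperˡ)
        (begin
          path us w t ⊙ (tu ⊙ star q ⊙ uv)                      ≈⟨ ⊙-assoc _ _ _ ⟨
          path us w t ⊙ (tu ⊙ star q) ⊙ uv                      ≈⟨ ⊙-cong (⊙-assoc _ _ _) ≈-refl ⟨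
          path us w t ⊙ tu ⊙ star q ⊙ uv                        ≤⟨ ⊙-monoˡ (⊙-monoˡ (path-trans us t∈us)) ⟩
          path us w u ⊙ star q ⊙ uv                             ≤⟨ ⊕-upperʳ ⟩
          path us w v ⊕ path us w u ⊙ star q ⊙ uv               ∎) ⟩
      path us w v ⊕ path us w u ⊙ star q ⊙ uv                   ∎

    viaU : ut ⊙ (tv ⊕ tu ⊙ star q ⊙ uv) ≦ star q ⊙ uv
    viaU = ≦-trans (expand u) (⊕-least ⊙-star-lowerʳ (⊙-monoˡ star-stepˡ))

-- Soundness

module Soundness (em : ExcludedMiddle 0ℓ) where

  -- As `e ≦ f` abbreviates `e ⊕ f ≈ f`, the backward inclusion for each inequality axiom is `inj₂`.
  -- Excluded middle enters only in `ad-compl` and `dom-def`, to decide whether a state has a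
  -- successor.
  sound : e ≈ f → ∀ M → SameRel (⟦ e ⟧ M) (⟦ f ⟧ M)
  sound ≈-refl M x y = (λ r → r) , (λ r → r)
  sound (≈-sym p) M x y = proj₂ (sound p M x y) , proj₁ (sound p M x y)
  sound (≈-trans p q) M x y =
    proj₁ (sound q M x y) ∘ proj₁ (sound p M x y) ,
    proj₂ (sound p M x y) ∘ proj₂ (sound q M x y)
  sound (⊕-cong p q) M x y =
    Sum.map (proj₁ (sound p M x y)) (proj₁ (sound q M x y)) ,
    Sum.map (proj₂ (sound p M x y)) (proj₂ (sound q M x y))
  sound (⊙-cong p q) M x y =
    (λ (z , r , s) → z , proj₁ (sound p M x z) r , proj₁ (sound q M z y) s) ,
    (λ (z , r , s) → z , proj₂ (sound p M x z) r , proj₂ (sound q M z y) s)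
  sound (ad-cong p) M x y =
    (λ (eq , n) → eq , λ (z , r) → n (z , proj₂ (sound p M x z) r)) ,
    (λ (eq , n) → eq , λ (z , r) → n (z , proj₁ (sound p M x z) r))
  sound (dom-cong p) M x y =
    (λ (eq , z , r) → eq , z , proj₁ (sound p M x z) r) ,
    (λ (eq , z , r) → eq , z , proj₂ (sound p M x z) r)
  sound (star-cong p) M x y =
    Star.map (proj₁ (sound p M _ _)) , Star.map (proj₂ (sound p M _ _))
  sound (⊕-assoc e f g) M x y = Sum.assocʳ , Sum.assocˡ
  sound (⊕-comm e f) M x y = Sum.swap , Sum.swap
  sound (⊕-idem e) M x y = Sum.reduce , inj₁
  sound (⊕-identʳ e) M x y = (λ { (inj₁ r) → r }) , inj₁
  sound (⊙-assoc e f g) M x y =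
    (λ (z , (w , r , s) , t) → w , r , z , s , t) ,
    (λ (w , r , z , s , t) → z , (w , r , s) , t)
  sound (⊙-identˡ e) M x y = (λ { (_ , refl , r) → r }) , (λ r → x , refl , r)
  sound (⊙-identʳ e) M x y = (λ { (_ , r , refl) → r }) , (λ r → y , r , refl)
  sound (distribˡ e f g) M x y =
    (λ { (z , r , inj₁ s) → inj₁ (z , r , s) ; (z , r , inj₂ s) → inj₂ (z , r , s) }) ,
    (λ { (inj₁ (z , r , s)) → z , r , inj₁ s ; (inj₂ (z , r , s)) → z , r , inj₂ s })
  sound (distribʳ e f g) M x y =
    (λ { (z , inj₁ r , s) → inj₁ (z , r , s) ; (z , inj₂ r , s) → inj₂ (z , r , s) }) ,
    (λ { (inj₁ (z , r , s)) → z , inj₁ r , s ; (inj₂ (z , r , s)) → z , inj₂ r , s })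
  sound (zeroˡ e) M x y = (λ ()) , (λ ())
  sound (zeroʳ e) M x y = (λ ()) , (λ ())
  sound (star-unfoldˡ e) M x y =
    (λ { (inj₁ (inj₁ refl)) → ε ; (inj₁ (inj₂ (_ , r , rs))) → r ◅ rs ; (inj₂ rs) → rs }) , inj₂
  sound (star-unfoldʳ e) M x y =
    (λ { (inj₁ (inj₁ refl)) → ε ; (inj₁ (inj₂ (_ , rs , r))) → rs ◅◅ (r ◅ ε) ; (inj₂ rs) → rs }) , inj₂
  sound (star-indˡ {e} {f} {g} p) M x y =
    [ (λ (z , rs , s) → run rs (proj₁ (sound p M z y) (inj₁ (inj₁ s)))) , (λ r → r) ]′ , inj₂
    where
    run : ∀ {x z} → Star (⟦ e ⟧ M) x z → ⟦ g ⟧ M z y → ⟦ g ⟧ M x y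
    run ε        s = s
    run (r ◅ rs) s = proj₁ (sound p M _ y) (inj₁ (inj₂ (_ , r , run rs s)))
  sound (star-indʳ {e} {f} {g} p) M x y =
    [ (λ (z , s , rs) → run (proj₁ (sound p M x z) (inj₁ (inj₁ s))) rs) , (λ r → r) ]′ , inj₂
    where
    run : ∀ {z y} → ⟦ g ⟧ M x z → Star (⟦ e ⟧ M) z y → ⟦ g ⟧ M x y
    run s ε        = s
    run s (r ◅ rs) = run (proj₁ (sound p M x _) (inj₁ (inj₂ (_ , s , r)))) rs
  sound (ad-annihil e) M x y = (λ { (_ , (refl , n) , r) → n (y , r) }) , (λ ())
  sound (ad-local e f) M x y =
    (λ (eq , n) → eq , λ { (_ , w , r , (refl , z , s)) → n (z , w , r , s) }) ,
    (λ (eq , n) → eq , λ (z , w , r , s) → n (w , w , r , (refl , z , s)))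
  sound (ad-compl e) M x y = [ proj₁ , proj₁ ]′ , λ eq → decide eq
    where
    decide : x ≡ y → ⟦ ad e ⊕ dom e ⟧ M x y
    decide eq with em {P = ∃ λ z → ⟦ e ⟧ M x z}
    ... | yes r = inj₂ (eq , r)
    ... | no  n = inj₁ (eq , n)
  sound (prop-dom p) M x y = (λ { (refl , _ , _ , s) → refl , s }) , (λ (eq , s) → eq , x , refl , s)
  sound (dom-def e) M x y =
    (λ (eq , z , r) → eq , λ (_ , _ , n) → n (z , r)) , λ (eq , n) → eq , decide n
    where
    decide : ¬ (∃ λ z → ⟦ ad e ⟧ M x z) → ∃ λ z → ⟦ e ⟧ M x z
    decide n with em {P = ∃ λ z → ⟦ e ⟧ M x z}
    ... | yes r = r
    ... | no  m = contradiction (x , refl , m) n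

-- Sums over decided predicates

module Comprehension (em : ExcludedMiddle 0ℓ) where

  -- The conditions will include provability statements, so excluded middle settles them; a false
  -- one contributes `𝟘`.
  when : Set → Exp → Exp
  when P e = if does (em {P}) then e else 𝟘

  when-upper : ∀ {P : Set} → P → e ≦ when P e
  when-upper {P = P} p with em {P}
  ... | yes _ = ≦-refl
  ... | no ¬p = contradiction p ¬p

  when-⊙-least : ∀ {P : Set} → (P → e ⊙ k ≦ y) → when P e ⊙ k ≦ y
  when-⊙-least {P = P} p with em {P}
  ... | yes q = p q
  ... | no  _ = ≦-trans (≈⇒≦ (zeroˡ _)) 𝟘≦

  ⨁ : ∀ {A : Set} → List A → (A → Set) → (A → Exp) → Exp
  ⨁ []       P F = 𝟘
  ⨁ (z ∷ zs) P F = when (P z) (F z) ⊕ ⨁ zs P F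

  module _ {A : Set} {P : A → Set} {F : A → Exp} where

    ⨁-upper : ∀ {z zs} → z ∈ zs → P z → F z ≦ ⨁ zs P F
    ⨁-upper (here refl)  p = ≦-trans (when-upper p) ⊕-upperˡ
    ⨁-upper (there z∈zs) p = ≦-trans (⨁-upper z∈zs p) ⊕-upperʳ

    ⨁-⊙-least : ∀ zs → (∀ z → P z → F z ⊙ k ≦ y) → ⨁ zs P F ⊙ k ≦ y
    ⨁-⊙-least []       p = ≦-trans (≈⇒≦ (zeroˡ _)) 𝟘≦
    ⨁-⊙-least (z ∷ zs) p =
      ≦-trans (≈⇒≦ (distribʳ _ _ _)) (⊕-least (when-⊙-least (p z)) (⨁-⊙-least zs p))

    ⨁-least : ∀ zs → (∀ z → P z → F z ≦ y) → ⨁ zs P F ≦ y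
    ⨁-least zs p = ≦-trans (≈⇒≦ (≈-sym (⊙-identʳ _)))
      (⨁-⊙-least zs λ z q → ≦-trans (≈⇒≦ (⊙-identʳ _)) (p z q))

  ⊙-⨁-least : ∀ {A : Set} {P : A → Set} {F : A → Exp} zs →
    (∀ z → P z → h ⊙ F z ≦ y) → h ⊙ ⨁ zs P F ≦ y
  ⊙-⨁-least []       p = ≦-trans (≈⇒≦ (zeroʳ _)) 𝟘≦
  ⊙-⨁-least {h} {y} {P = P} {F} (z ∷ zs) p =
    ≦-trans (≈⇒≦ (distribˡ _ _ _)) (⊕-least head (⊙-⨁-least zs p))
    where
    head : h ⊙ when (P z) (F z) ≦ y
    head with em {P z}
    ... | yes q = p z q
    ... | no  _ = ≦-trans (≈⇒≦ (zeroʳ _)) 𝟘≦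

  -- Subsets are stored as bits so that there are finitely many states to list.
  subset : ∀ {n} → (Fin n → Set) → Vec Bool n
  subset P = Vec.tabulate λ i → does (em {P i})

  subset⁺ : ∀ {n} (P : Fin n → Set) i → P i → Vec.lookup (subset P) i ≡ true
  subset⁺ P i p = trans (lookup∘tabulate _ i) holds
    where
    holds : does (em {P i}) ≡ true
    holds with em {P i}
    ... | yes _ = refl
    ... | no ¬p = contradiction p ¬p

  subset⁻ : ∀ {n} (P : Fin n → Set) i → Vec.lookup (subset P) i ≡ true → P i
  subset⁻ P i eq = holds (trans (sym (lookup∘tabulate _ i)) eq)
    where
    holds : does (em {P i}) ≡ true → P i
    holds eq with em {P i}
    holds eq | yes p = p
    holds () | no  _

bitVectors : ∀ n → List (Vec Bool n)
bitVectors zero    = [ [] ]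
bitVectors (suc n) = map (true ∷_) (bitVectors n) ++ map (false ∷_) (bitVectors n)

∈-bitVectors : ∀ {n} (bs : Vec Bool n) → bs ∈ bitVectors n
∈-bitVectors []           = here refl
∈-bitVectors (true  ∷ bs) = ∈-++⁺ˡ (∈-map⁺ _ (∈-bitVectors bs))
∈-bitVectors (false ∷ bs) = ∈-++⁺ʳ _ (∈-map⁺ _ (∈-bitVectors bs))

-- The canonical model

-- An analogue of the Fischer–Ladner closure: the expressions whose domain the atoms must
-- decide. Splitting off actions at the leaves with explicit continuations keeps it finite.
tested : Exp → Exp → List Exp
tested (act a)  k = [ act a ⊙ k ]
tested (prop p) k = [ prop p ]
tested 𝟘        k = []
tested 𝟙        k = []
tested (e ⊕ f)  k = tested e k ++ tested f k
tested (e ⊙ f)  k = tested e (f ⊙ k) ++ tested f k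
tested (ad e)   k = tested e 𝟙
tested (dom e)  k = tested e 𝟙
tested (star e) k = tested e (star e ⊙ k)

-- What may remain of e ⊙ k just after an action of e (outside its tests): these
-- play the role of the partial derivatives of e ⊙ k.
continuations : Exp → Exp → List Exp
continuations (act a)  k = [ k ]
continuations (prop p) k = []
continuations 𝟘        k = []
continuations 𝟙        k = []
continuations (e ⊕ f)  k = continuations e k ++ continuations f k
continuations (e ⊙ f)  k = continuations e (f ⊙ k) ++ continuations f k
continuations (ad e)   k = []
continuations (dom e)  k = []
continuations (star e) k = continuations e (star e ⊙ k)

actions : Exp → List Act
actions (act a)  = [ a ]
actions (prop p) = []
actions 𝟘        = []
actions 𝟙        = []
actions (e ⊕ f)  = actions e ++ actions f
actions (e ⊙ f)  = actions e ++ actions f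
actions (ad e)   = actions e
actions (dom e)  = actions e
actions (star e) = actions e

++-⊆ˡ : ∀ {A : Set} {xs ys zs : List A} → xs ++ ys ⊆ zs → xs ⊆ zs
++-⊆ˡ p = p ∘ ∈-++⁺ˡ

++-⊆ʳ : ∀ {A : Set} (xs : List A) {ys zs : List A} → xs ++ ys ⊆ zs → ys ⊆ zs
++-⊆ʳ xs p = p ∘ ∈-++⁺ʳ xs

-- The inductions assume only inclusions into `D`, `K` and `A`, so they descend to subexpressions
-- while the model stays fixed.
module Canonical (em : ExcludedMiddle 0ℓ) (D K : List Exp) (A : List Act) where
  open Comprehension em

  -- The second component selects positions in K.
  State : Set
  State = Vec Bool (length D) × Vec Bool (length K)

  states : List State
  states = cartesianProduct (bitVectors _) (bitVectors _)

  ∈-states : ∀ s → s ∈ states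
  ∈-states (bs , V) = ∈-cartesianProduct⁺ (∈-bitVectors bs) (∈-bitVectors V)

  at : State → Exp
  at s = atom D (proj₁ s)

  at≦𝟙 : ∀ s → at s ≦ 𝟙
  at≦𝟙 s = atom≦𝟙 D (proj₁ s)

  at-idem : ∀ s → at s ⊙ at s ≈ at s
  at-idem s = atom-idem D (proj₁ s)

  _∋_ : State → Fin (length K) → Set
  s ∋ i = Vec.lookup (proj₂ s) i ≡ true

  Continues : State → Act → Vec Bool (length D) → Fin (length K) → Set
  Continues s a bs j = ∃ λ i → s ∋ i × at s ⊙ act a ⊙ atom D bs ⊙ lookup K j ≦ lookup K i

  next : State → Act → Vec Bool (length D) → Vec Bool (length K)
  next s a bs = subset (Continues s a bs)

  model : Model
  model = record
    { X   = State
    ; rel = λ a s t → ¬ (at s ⊙ act a ⊙ at t ≈ 𝟘) × proj₂ t ≡ next s a (proj₁ t)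
    ; sat = λ p s → at s ≦ prop p }

  -- The diagonal summand makes route reflexive, so that it also covers tests.
  edge : State → State → Exp
  edge s t = when (s ≡ t) (at s) ⊕ ⨁ A (λ a → Model.rel model a s t) (λ a → at s ⊙ act a ⊙ at t)

  open Path edge

  -- The trailing `at t` lets a bound on `at t ⊙ h` be applied at the end of the path.
  route : State → State → Exp
  route s t = path states s t ⊙ at t

  routes : (State → Set) → State → Exp
  routes P s = ⨁ states P (route s)

  at≦routes : ∀ {P s} → P s → at s ≦ routes P s
  at≦routes {P} {s} p = begin
    at s                     ≈⟨ at-idem s ⟨
    at s ⊙ at s              ≤⟨ ⊙-monoˡ (≦-trans (when-upper refl) (≦-trans ⊕-upperˡ (edge≦path states))) ⟩
    route s s                ≤⟨ ⨁-upper (∈-states s) p ⟩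
    routes P s               ∎

  -- `path-trans` glues the two paths at the intermediate state `t`. This serves products and, with
  -- `R` equal to `P`, the induction for `star`.
  routes-⊙ : ∀ {P R : State → Set} {Q : State → State → Set} {s} →
    (∀ t → at t ⊙ h ≦ routes (Q t) t) → (∀ {t u} → P t → Q t u → R u) →
    routes P s ⊙ h ≦ routes R s
  routes-⊙ {h} {P} {R} {Q} {s} step join = ⨁-⊙-least states λ t p → begin
    path states s t ⊙ at t ⊙ h               ≈⟨ ⊙-assoc _ _ _ ⟩
    path states s t ⊙ (at t ⊙ h)             ≤⟨ ⊙-monoʳ (step t) ⟩
    path states s t ⊙ routes (Q t) t         ≤⟨ ⊙-⨁-least states (λ u q → begin
      path states s t ⊙ (path states t u ⊙ at u)   ≈⟨ ⊙-assoc _ _ _ ⟨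
      path states s t ⊙ path states t u ⊙ at u     ≤⟨ ⊙-monoˡ (path-trans states (∈-states t)) ⟩
      route s u                                    ≤⟨ ⨁-upper (∈-states u) (join p q) ⟩
      routes R s                                   ∎) ⟩
    routes R s                               ∎

  routes-mono : ∀ {P R : State → Set} {s} → (∀ {t} → P t → R t) → routes P s ≦ routes R s
  routes-mono p = ⨁-least states λ t q → ⨁-upper (∈-states t) (p q)

  -- Evaluation of expressions in the canonical model

  at≦dom : ∀ s → at s ≦ x → at s ≦ dom x
  at≦dom s p = ≦-trans (atom≦dom-atom D (proj₁ s)) (dom-mono p)

  at≦dom-⊙ : ∀ s → at s ≦ x → at s ≦ dom k → at s ≦ dom (x ⊙ k)
  at≦dom-⊙ {x} {k} s p q = begin
    at s                ≤⟨ at≦dom s (≈⇒≦ (≈-sym (at-idem s))) ⟩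
    dom (at s ⊙ at s)   ≤⟨ dom-mono (⊙-mono p q) ⟩
    dom (x ⊙ dom k)     ≈⟨ dom-local ⟩
    dom (x ⊙ k)         ∎

  Runs : Exp → State → State → Set
  Runs e = ⟦ e ⟧ model

  mutual

    -- Tests force the mutual induction: if `e` has a run from `s`, then `at s ≦ dom e`; if not, the
    -- sum of routes is empty and `at s ≦ ad e`. So the atom decides `ad e` and `dom e` as the model
    -- does. `k` is the continuation that `tested` carries along.
    at-⊙≦routes : ∀ e k → tested e k ⊆ D → actions e ⊆ A →
      ∀ s → at s ⊙ e ≦ routes (Runs e s) s
    at-⊙≦routes (act a) k D⊆ A⊆ s =
      -- Every atom is tried after the action; a nonzero product determines a successor, with `next`
      -- as its subset.
      ≦-trans (≈⇒≦ (≈-sym (⊙-identʳ _))) (atom-split D successor)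
      where
      successor : ∀ bs → at s ⊙ act a ⊙ atom D bs ⊙ 𝟙 ≦ routes (Runs (act a) s) s
      successor bs with em {at s ⊙ act a ⊙ atom D bs ≈ 𝟘}
      ... | yes z = ≦-trans (≈⇒≦ (≈-trans (⊙-identʳ _) z)) 𝟘≦
      ... | no nz = begin
        at s ⊙ act a ⊙ at t ⊙ 𝟙           ≈⟨ ⊙-identʳ _ ⟩
        -- One copy of `at t` completes the edge, the other ends the route.
        at s ⊙ act a ⊙ at t               ≈⟨ ⊙-cong ≈-refl (at-idem t) ⟨
        at s ⊙ act a ⊙ (at t ⊙ at t)      ≈⟨ ⊙-assoc _ _ _ ⟨
        at s ⊙ act a ⊙ at t ⊙ at t        ≤⟨ ⊙-monoˡ (≦-trans (⨁-upper (A⊆ (here refl)) (nz , refl))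
                                               (≦-trans ⊕-upperʳ (edge≦path states))) ⟩
        route s t                         ≤⟨ ⨁-upper (∈-states t) (nz , refl) ⟩
        routes (Runs (act a) s) s         ∎
        where
        t : State
        t = bs , next s a bs
    at-⊙≦routes (prop p) k D⊆ A⊆ s with atom-decides D (proj₁ s) (D⊆ (here refl))
    ... | inj₁ q = ≦-trans (≦𝟙⇒⊙-lowerˡ (≦-trans (≈⇒≦ (≈-sym (prop-dom p))) dom≦𝟙))
                     (at≦routes (refl , ≦-trans q (≈⇒≦ (prop-dom p))))
    ... | inj₂ q = ≦-trans (≈⇒≦ (≦ad⇒⊙≈𝟘 q)) 𝟘≦
    at-⊙≦routes 𝟘 k D⊆ A⊆ s = ≦-trans (≈⇒≦ (zeroʳ _)) 𝟘≦
    at-⊙≦routes 𝟙 k D⊆ A⊆ s = ≦-trans (≈⇒≦ (⊙-identʳ _)) (at≦routes refl)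
    at-⊙≦routes (e ⊕ f) k D⊆ A⊆ s = ≦-trans (≈⇒≦ (distribˡ _ _ _)) (⊕-least
      (≦-trans (at-⊙≦routes e k (++-⊆ˡ D⊆) (++-⊆ˡ A⊆) s) (routes-mono inj₁))
      (≦-trans (at-⊙≦routes f k (++-⊆ʳ (tested e k) D⊆) (++-⊆ʳ (actions e) A⊆) s) (routes-mono inj₂)))
    at-⊙≦routes (e ⊙ f) k D⊆ A⊆ s = begin
      at s ⊙ (e ⊙ f)             ≈⟨ ⊙-assoc _ _ _ ⟨
      at s ⊙ e ⊙ f               ≤⟨ ⊙-monoˡ (at-⊙≦routes e (f ⊙ k) (++-⊆ˡ D⊆) (++-⊆ˡ A⊆) s) ⟩
      routes (Runs e s) s ⊙ f    ≤⟨ routes-⊙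
        (at-⊙≦routes f k (++-⊆ʳ (tested e (f ⊙ k)) D⊆) (++-⊆ʳ (actions e) A⊆))
        (λ {t} r q → t , r , q) ⟩
      routes (Runs (e ⊙ f) s) s  ∎
    at-⊙≦routes (ad e) k D⊆ A⊆ s with em {∃ (Runs e s)}
    ... | yes r = ≦-trans (⊙-monoˡ (Runs⇒at≦dom e D⊆ A⊆ r)) (≦-trans (≈⇒≦ dom⊙ad≈𝟘) 𝟘≦)
    ... | no ¬r = ≦-trans (≦𝟙⇒⊙-lowerˡ ad≦𝟙) (at≦routes (refl , ¬r))
    at-⊙≦routes (dom e) k D⊆ A⊆ s with em {∃ (Runs e s)}
    ... | yes r = ≦-trans (≦𝟙⇒⊙-lowerˡ dom≦𝟙) (at≦routes (refl , r))
    ... | no ¬r = ≦-trans (⊙-monoˡ (¬Runs⇒at≦ad e 𝟙 D⊆ A⊆ ¬r)) (≦-trans (≈⇒≦ ad⊙dom≈𝟘) 𝟘≦)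
    -- The routes for runs of `star e` are invariant under multiplication by `e` on the right, as
    -- `star-indʳ` demands.
    at-⊙≦routes (star e) k D⊆ A⊆ s = star-indʳ (⊕-least (at≦routes ε)
      (routes-⊙ (at-⊙≦routes e (star e ⊙ k) D⊆ A⊆) (λ rs r → rs ◅◅ (r ◅ ε))))

    ¬Runs⇒at≦ad : ∀ e k → tested e k ⊆ D → actions e ⊆ A →
      ∀ {s} → ¬ ∃ (Runs e s) → at s ≦ ad e
    ¬Runs⇒at≦ad e k D⊆ A⊆ {s} ¬r = ⊙≈𝟘⇒≦ad (at≦𝟙 s) (≦𝟘⇒≈𝟘
      (≦-trans (at-⊙≦routes e k D⊆ A⊆ s) (⨁-least states λ t r → contradiction (t , r) ¬r)))

    Runs⇒at≦dom : ∀ e → tested e 𝟙 ⊆ D → actions e ⊆ A →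
      ∀ {s} → ∃ (Runs e s) → at s ≦ dom e
    Runs⇒at≦dom e D⊆ A⊆ (t , r) = ≦-trans
      (Runs⇒at≦dom-⊙ e 𝟙 D⊆ A⊆ r (at≦dom t (at≦𝟙 t)))
      (dom-mono (≈⇒≦ (⊙-identʳ _)))

    -- The continuation `k` is carried because the domains of two factors do not determine the
    -- domain of their product.
    Runs⇒at≦dom-⊙ : ∀ e k → tested e k ⊆ D → actions e ⊆ A →
      ∀ {s t} → Runs e s t → at t ≦ dom k → at s ≦ dom (e ⊙ k)
    Runs⇒at≦dom-⊙ (act a) k D⊆ A⊆ {s} {t} (nz , _) p
      with atom-decides D (proj₁ s) (D⊆ (here refl))
    ... | inj₁ q = q
    -- Here `at s ⊙ act a ⊙ dom k` vanishes, and with it `at s ⊙ act a ⊙ at t`, which a transition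
    -- requires to be nonzero.
    ... | inj₂ q = contradiction
      (≦𝟘⇒≈𝟘 (≦-trans (⊙-monoʳ p) (≈⇒≦ (⊙≈𝟘⇒⊙dom≈𝟘 (≈-trans (⊙-assoc _ _ _) (≦ad⇒⊙≈𝟘 q)))))) nz
    Runs⇒at≦dom-⊙ (prop p) k D⊆ A⊆ {s} (refl , r) q = at≦dom-⊙ s r q
    Runs⇒at≦dom-⊙ 𝟙 k D⊆ A⊆ {s} refl q = at≦dom-⊙ s (at≦𝟙 s) q
    Runs⇒at≦dom-⊙ (e ⊕ f) k D⊆ A⊆ (inj₁ r) q = ≦-trans
      (Runs⇒at≦dom-⊙ e k (++-⊆ˡ D⊆) (++-⊆ˡ A⊆) r q) (dom-mono (⊙-monoˡ ⊕-upperˡ))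
    Runs⇒at≦dom-⊙ (e ⊕ f) k D⊆ A⊆ (inj₂ r) q = ≦-trans
      (Runs⇒at≦dom-⊙ f k (++-⊆ʳ (tested e k) D⊆) (++-⊆ʳ (actions e) A⊆) r q) (dom-mono (⊙-monoˡ ⊕-upperʳ))
    Runs⇒at≦dom-⊙ (e ⊙ f) k D⊆ A⊆ (_ , r , r′) q = ≦-trans
      (Runs⇒at≦dom-⊙ e (f ⊙ k) (++-⊆ˡ D⊆) (++-⊆ˡ A⊆) r
        (Runs⇒at≦dom-⊙ f k (++-⊆ʳ (tested e (f ⊙ k)) D⊆) (++-⊆ʳ (actions e) A⊆) r′ q))
      (dom-mono (≈⇒≦ (≈-sym (⊙-assoc _ _ _))))
    Runs⇒at≦dom-⊙ (ad e) k D⊆ A⊆ {s} (refl , ¬r) q = at≦dom-⊙ s (¬Runs⇒at≦ad e 𝟙 D⊆ A⊆ ¬r) q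
    Runs⇒at≦dom-⊙ (dom e) k D⊆ A⊆ {s} (refl , r) q = at≦dom-⊙ s (Runs⇒at≦dom e D⊆ A⊆ r) q
    Runs⇒at≦dom-⊙ (star e) k D⊆ A⊆ {t = t} rs q = run rs
      where
      run : ∀ {s} → Star (Runs e) s t → at s ≦ dom (star e ⊙ k)
      run ε        = ≦-trans q (dom-mono ⊙-star-lowerʳ)
      run (r ◅ rs) = ≦-trans (Runs⇒at≦dom-⊙ e (star e ⊙ k) D⊆ A⊆ r (run rs))
        (dom-mono (≦-trans (≈⇒≦ (≈-sym (⊙-assoc _ _ _))) (⊙-monoˡ star-stepˡ)))

  -- Remaining continuations along a run

  _⊩_ : State → Exp → Set
  s ⊩ k = ∃ λ i → s ∋ i × at s ⊙ k ≦ lookup K i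

  ⊩-anti : ∀ s → at s ⊙ e ≦ at s ⊙ f → s ⊩ f → s ⊩ e
  ⊩-anti s p (i , s∋i , q) = i , s∋i , ≦-trans p q

  ⊩-test : ∀ s → at s ≦ x → s ⊩ (x ⊙ k) → s ⊩ k
  ⊩-test {x} {k} s p = ⊩-anti s (begin
    at s ⊙ k              ≈⟨ ⊙-cong (at-idem s) ≈-refl ⟨
    at s ⊙ at s ⊙ k       ≤⟨ ⊙-monoˡ (⊙-monoʳ p) ⟩
    at s ⊙ x ⊙ k          ≈⟨ ⊙-assoc _ _ _ ⟩
    at s ⊙ (x ⊙ k)        ∎)

  Runs-⊩ : ∀ e k → tested e k ⊆ D → continuations e k ⊆ K → actions e ⊆ A →
    ∀ {s t} → Runs e s t → s ⊩ (e ⊙ k) → t ⊩ k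
  Runs-⊩ (act a) k D⊆ K⊆ A⊆ {s} {t} (_ , eq) (i , s∋i , p) =
    index k∈K ,
    subst (λ V → Vec.lookup V (index k∈K) ≡ true) (sym eq)
      (subset⁺ (Continues s a (proj₁ t)) (index k∈K) (i , s∋i , continue)) ,
    ≦-trans (≦𝟙⇒⊙-lowerʳ (at≦𝟙 t)) (≈⇒≦ (≡⇒≈ (lookup-index k∈K)))
    where
    ≡⇒≈ : e ≡ f → e ≈ f
    ≡⇒≈ refl = ≈-refl
    k∈K = K⊆ (here refl)
    continue : at s ⊙ act a ⊙ at t ⊙ lookup K (index k∈K) ≦ lookup K i
    continue = begin
      at s ⊙ act a ⊙ at t ⊙ lookup K (index k∈K)  ≈⟨ ⊙-cong ≈-refl (≡⇒≈ (lookup-index k∈K)) ⟨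
      at s ⊙ act a ⊙ at t ⊙ k                     ≤⟨ ⊙-monoˡ (≦𝟙⇒⊙-lowerˡ (at≦𝟙 t)) ⟩
      at s ⊙ act a ⊙ k                            ≈⟨ ⊙-assoc _ _ _ ⟩
      at s ⊙ (act a ⊙ k)                          ≤⟨ p ⟩
      lookup K i                                  ∎
  Runs-⊩ (prop p) k D⊆ K⊆ A⊆ {s} (refl , r) = ⊩-test s r
  Runs-⊩ 𝟙 k D⊆ K⊆ A⊆ {s} refl = ⊩-test s (at≦𝟙 s)
  Runs-⊩ (e ⊕ f) k D⊆ K⊆ A⊆ {s} (inj₁ r) q =
    Runs-⊩ e k (++-⊆ˡ D⊆) (++-⊆ˡ K⊆) (++-⊆ˡ A⊆) r
      (⊩-anti s (⊙-monoʳ (⊙-monoˡ ⊕-upperˡ)) q)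
  Runs-⊩ (e ⊕ f) k D⊆ K⊆ A⊆ {s} (inj₂ r) q =
    Runs-⊩ f k (++-⊆ʳ (tested e k) D⊆) (++-⊆ʳ (continuations e k) K⊆) (++-⊆ʳ (actions e) A⊆) r
      (⊩-anti s (⊙-monoʳ (⊙-monoˡ ⊕-upperʳ)) q)
  Runs-⊩ (e ⊙ f) k D⊆ K⊆ A⊆ {s} (_ , r , r′) q =
    Runs-⊩ f k (++-⊆ʳ (tested e (f ⊙ k)) D⊆) (++-⊆ʳ (continuations e (f ⊙ k)) K⊆) (++-⊆ʳ (actions e) A⊆) r′
      (Runs-⊩ e (f ⊙ k) (++-⊆ˡ D⊆) (++-⊆ˡ K⊆) (++-⊆ˡ A⊆) r
        (⊩-anti s (⊙-monoʳ (≈⇒≦ (≈-sym (⊙-assoc _ _ _)))) q))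
  Runs-⊩ (ad e) k D⊆ K⊆ A⊆ {s} (refl , ¬r) = ⊩-test s (¬Runs⇒at≦ad e 𝟙 D⊆ A⊆ ¬r)
  Runs-⊩ (dom e) k D⊆ K⊆ A⊆ {s} (refl , r) = ⊩-test s (Runs⇒at≦dom e D⊆ A⊆ r)
  Runs-⊩ (star e) k D⊆ K⊆ A⊆ {t = t} rs q = run rs q
    where
    run : ∀ {s} → Star (Runs e) s t → s ⊩ (star e ⊙ k) → t ⊩ k
    run {s} ε        q = ⊩-anti s (⊙-monoʳ ⊙-star-lowerʳ) q
    run {s} (r ◅ rs) q = run rs (Runs-⊩ e (star e ⊙ k) D⊆ K⊆ A⊆ r
      (⊩-anti s (⊙-monoʳ (≦-trans (≈⇒≦ (≈-sym (⊙-assoc _ _ _))) (⊙-monoˡ star-stepˡ))) q))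

  -- The family to which `path-least` is applied: an upper bound for what may still be done from
  -- `s`.
  total : State → Exp
  total s = at s ⊙ ⨁ (allFin _) (s ∋_) (lookup K)

  ≦total : ∀ s {i} → s ∋ i → at s ⊙ lookup K i ≦ total s
  ≦total s {i} s∋i = ⊙-monoʳ (⨁-upper (∈-allFin i) s∋i)

  edge-⊙-total : ∀ s t → edge s t ⊙ total t ≦ total s
  edge-⊙-total s t = ≦-trans (≈⇒≦ (distribʳ _ _ _)) (⊕-least
    (when-⊙-least λ { refl → ≦𝟙⇒⊙-lowerʳ (at≦𝟙 s) })
    -- Matching `refl` turns the subset of `t` into `next s a (proj₁ t)`, so each continuation
    -- selected at `t` traces back to one selected at `s`.
    (⨁-⊙-least A λ { a (_ , refl) → begin
      at s ⊙ act a ⊙ at t ⊙ total t                             ≈⟨ ⊙-assoc _ _ _ ⟨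
      at s ⊙ act a ⊙ at t ⊙ at t ⊙ ⨁ (allFin _) (t ∋_) (lookup K)
        ≤⟨ ⊙-monoˡ (≦𝟙⇒⊙-lowerˡ (at≦𝟙 t)) ⟩
      at s ⊙ act a ⊙ at t ⊙ ⨁ (allFin _) (t ∋_) (lookup K)
        ≤⟨ ⊙-⨁-least (allFin _) (λ j t∋j → continue a j (subset⁻ (Continues s a (proj₁ t)) j t∋j)) ⟩
      total s                                                   ∎ }))
    where
    continue : ∀ a j → Continues s a (proj₁ t) j →
      at s ⊙ act a ⊙ at t ⊙ lookup K j ≦ total s
    continue a j (i , s∋i , p) = begin
      -- The doubled `at s` supplies the prefix of `total s`.
      at s ⊙ act a ⊙ at t ⊙ lookup K j            ≈⟨ ⊙-cong (⊙-cong (⊙-cong (at-idem s) ≈-refl) ≈-refl) ≈-refl ⟨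
      at s ⊙ at s ⊙ act a ⊙ at t ⊙ lookup K j     ≈⟨ ⊙-cong (⊙-cong (⊙-assoc _ _ _) ≈-refl) ≈-refl ⟩
      at s ⊙ (at s ⊙ act a) ⊙ at t ⊙ lookup K j   ≈⟨ ⊙-cong (⊙-assoc _ _ _) ≈-refl ⟩
      at s ⊙ (at s ⊙ act a ⊙ at t) ⊙ lookup K j   ≈⟨ ⊙-assoc _ _ _ ⟩
      at s ⊙ (at s ⊙ act a ⊙ at t ⊙ lookup K j)   ≤⟨ ⊙-monoʳ p ⟩
      at s ⊙ lookup K i                           ≤⟨ ≦total s s∋i ⟩
      total s                                     ∎

  -- `t ⊩ 𝟙` plays the role of acceptance: a run of `f` may stop at `t`.
  ⊩𝟙⇒at≦total : ∀ t → t ⊩ 𝟙 → at t ≦ total t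
  ⊩𝟙⇒at≦total t (i , t∋i , p) = begin
    at t                 ≈⟨ at-idem t ⟨
    at t ⊙ at t          ≤⟨ ⊙-monoʳ (≦-trans (≈⇒≦ (≈-sym (⊙-identʳ _))) p) ⟩
    at t ⊙ lookup K i    ≤⟨ ≦total t t∋i ⟩
    total t              ∎

  route≦total : ∀ s t → t ⊩ 𝟙 → route s t ≦ total s
  route≦total s t p =
    ≦-trans (⊙-monoʳ (⊩𝟙⇒at≦total t p)) (path-least edge-⊙-total states s t)

-- Completeness

module Completeness (em : ExcludedMiddle 0ℓ) where

  complete : (∀ M x y → ⟦ e ⟧ M x y → ⟦ f ⟧ M x y) → e ≦ f
  complete {e} {f} e⊆f =
    ≦-trans (≈⇒≦ (≈-sym (⊙-identˡ _))) (atom-split D λ bs →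
      ≦-trans (⊙-monoˡ (≈⇒≦ (⊙-identˡ _))) (below bs))
    where
    -- Atoms must decide the tests of both expressions, whereas only what remains of `f` is tracked.
    -- `f` heads `K` so that the initial state can select it.
    D = tested e 𝟙 ++ tested f 𝟙
    K = f ∷ continuations f 𝟙
    A = actions e ++ actions f
    open Comprehension em
    open Canonical em D K A

    below : ∀ bs → atom D bs ⊙ e ≦ f
    below bs = begin
      at s ⊙ e                ≤⟨ at-⊙≦routes e 𝟙 (++-⊆ˡ λ z → z) (++-⊆ˡ λ z → z) s ⟩
      routes (Runs e s) s     ≤⟨ ⨁-least states (λ t r → route≦total s t
        (Runs-⊩ f 𝟙 (++-⊆ʳ (tested e 𝟙) λ z → z) there (++-⊆ʳ (actions e) λ z → z)
          (e⊆f model s t r) initial)) ⟩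
      total s                 ≤⟨ ⊙-⨁-least (allFin _) (subset⁻ Initial) ⟩
      f                       ∎
      where
      -- The largest selection that keeps `total s ≦ f`; it contains position zero, where `f` itself
      -- stands.
      Initial : Fin (length K) → Set
      Initial i = atom D bs ⊙ lookup K i ≦ f
      s : State
      s = bs , subset Initial
      initial : s ⊩ (f ⊙ 𝟙)
      initial = Fin.zero , subset⁺ Initial Fin.zero (≦𝟙⇒⊙-lowerʳ (atom≦𝟙 D bs)) ,
        ≦-trans (≦𝟙⇒⊙-lowerʳ (atom≦𝟙 D bs)) (≈⇒≦ (⊙-identʳ _))

theorem4 : ExcludedMiddle 0ℓ →
    ∀ (e f : Exp) → (e ≈ f) ⇔ (∀ (M : Model) → SameRel (⟦ e ⟧ M) (⟦ f ⟧ M))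
theorem4 em e f = mk⇔ (Soundness.sound em) λ same → ≦-antisym
  (complete λ M x y → proj₁ (same M x y))
  (complete λ M x y → proj₂ (same M x y))
  where open Completeness em
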